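{- (i) Let $G_1$ and $G_2$ be two cubic graphs, let $u\in V(G_1)$ and $v\in V(G_2)$, and let $G_1(u)*G_2(v)$ be a graph obtained by a star product on $u$ and $v$. If $G_1(u)*G_2(v)$ is PMH, then $G_1$ and $G_2$ are PMH. (ii) The converse of (i) is not true: there exist cubic PMH-graphs $G_1$ and $G_2$, vertices $u\in V(G_1)$ and $v\in V(G_2)$, and a graph $G_1(u)*G_2(v)$ obtained by a star product on $u$ and $v$ which is not PMH.
   Context: Graphs are finite and connected, may have multiple (parallel) edges, and have no loops. A cubic graph is a 3-regular graph. A perfect matching is the edge set of a $1$-regular spanning subgraph, and a Hamiltonian cycle is a connected $2$-regular spanning subgraph. A graph admitting a perfect matching is PMH if each of its perfect matchings is contained in the edge set of a Hamiltonian cycle of the graph. Star product: let $u\in V(G_1)$, $v\in V(G_2)$ be vertices of degree 3, with incident edges $uu_1,uu_2,uu_3$ and $vv_1,vv_2,vv_3$ respectively. A star product on $u$ and $v$, denoted $G_1(u)*G_2(v)$, is the graph $(G_1-u)\cup(G_2-v)\cup\{u_1v_1,u_2v_2,u_3v_3\}$; different orderings of the neighbours may give different graphs, and the notation $G_1(u)*G_2(v)$ stands for any one of them. It is assumed that neither $G_1$ nor $G_2$ is the cubic graph on two vertices (three parallel edges). -}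

module Defs where

open import Data.Nat using (ℕ; NonZero)
open import Data.Fin using (Fin; _≟_)
open import Data.Fin.Subset using (Subset; _∈_; _⊆_; _∩_; ∣_∣; ⊤)
open import Data.Vec using (tabulate)
open import Data.Product using (_×_; _,_; Σ-syntax; ∃-syntax; proj₁; proj₂; map; swap)
open import Data.Sum using (_⊎_; inj₁; inj₂)
open import Function.Bundles using (_↔_; Inverse)
open import Function.Definitions using (Injective)
open import Relation.Binary.Construct.Closure.ReflexiveTransitive using (Star)
open import Relation.Binary.PropositionalEquality using (_≡_; _≢_; sym)
open import Relation.Nullary using (¬_; Dec; does; _⊎-dec_)

-- An undirected multigraph with vertex set V and edge set E is given by a map
-- ends : E → V × V.  The order of the two ends carries no information, so pairs
-- are always compared up to swapping; distinct edges may have the same ends.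

infix 4 _≈_

_≈_ : {V : Set} → V × V → V × V → Set
p ≈ q = p ≡ q ⊎ p ≡ swap q

module _ {V E : Set} (ends : E → V × V) where

  Incident : V → E → Set
  Incident x e = x ≡ proj₁ (ends e) ⊎ x ≡ proj₂ (ends e)

  Joins : E → V → V → Set
  Joins e x y = ends e ≈ (x , y)

module _ {n m : ℕ} (ends : Fin m → Fin n × Fin n) where

  incident? : ∀ x e → Dec (Incident ends x e)
  incident? x e = (x ≟ proj₁ (ends e)) ⊎-dec (x ≟ proj₂ (ends e))

  edgesAt : Fin n → Subset m
  edgesAt x = tabulate (λ e → does (incident? x e))

  -- A spanning subgraph is represented by its set S of edges.

  degreeIn : Subset m → Fin n → ℕ
  degreeIn S x = ∣ S ∩ edgesAt x ∣

  RegularSpanning : ℕ → Subset m → Set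
  RegularSpanning k S = ∀ x → degreeIn S x ≡ k

  ConnectedSpanning : Subset m → Set
  ConnectedSpanning S = ∀ x y → Star (λ a b → ∃[ e ] (e ∈ S × Joins ends e a b)) x y

record Graph : Set where
  field
    order     : ℕ
    size      : ℕ
    nonEmpty  : NonZero order
    ends      : Fin size → Fin order × Fin order
    loopless  : ∀ e → proj₁ (ends e) ≢ proj₂ (ends e)
    connected : ConnectedSpanning ends ⊤

  Vertex : Set
  Vertex = Fin order

  Edge : Set
  Edge = Fin size

open Graph public using (order; size; ends; Vertex; Edge)

Cubic : Graph → Set
Cubic G = RegularSpanning (ends G) 3 ⊤

PerfectMatching : (G : Graph) → Subset (size G) → Set
PerfectMatching G M = RegularSpanning (ends G) 1 M

HamiltonianCycle : (G : Graph) → Subset (size G) → Set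
HamiltonianCycle G H = RegularSpanning (ends G) 2 H × ConnectedSpanning (ends G) H

PMH : Graph → Set
PMH G = (∃[ M ] PerfectMatching G M)
      × (∀ M → PerfectMatching G M → ∃[ H ] (HamiltonianCycle G H × M ⊆ H))

-- Vertices and edges of G - u.  Negations are judgementally proof-irrelevant,
-- so these Σ-types are genuine subsets.

_∖ᵛ_ : (G : Graph) → Vertex G → Set
G ∖ᵛ u = Σ[ x ∈ Vertex G ] x ≢ u

_∖ᵉ_ : (G : Graph) → Vertex G → Set
G ∖ᵉ u = Σ[ e ∈ Edge G ] ¬ Incident (ends G) u e

deleteEnds : (G : Graph) (u : Vertex G) → G ∖ᵉ u → (G ∖ᵛ u) × (G ∖ᵛ u)
deleteEnds G u (e , u∉e) =
  (proj₁ (ends G e) , λ eq → u∉e (inj₁ (sym eq))) ,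
  (proj₂ (ends G e) , λ eq → u∉e (inj₂ (sym eq)))

-- A vertex u of degree 3 together with an ordering uu₁, uu₂, uu₃ of its
-- incident edges.  The edges are distinct, but in the presence of parallel edges
-- the neighbours u₁, u₂, u₃ need not be.

record OrderedStar (G : Graph) (u : Vertex G) : Set where
  field
    edge      : Fin 3 → Edge G
    neighbour : Fin 3 → G ∖ᵛ u
    joins     : ∀ i → Joins (ends G) (edge i) u (proj₁ (neighbour i))
    distinct  : Injective _≡_ _≡_ edge
    complete  : ∀ e → Incident (ends G) u e → ∃[ i ] e ≡ edge i

-- The graph (G₁ - u) ∪ (G₂ - v) ∪ {u₁v₁, u₂v₂, u₃v₃}; the index i : Fin 3 is the
-- edge uᵢvᵢ.

module _ (G₁ : Graph) (u : Vertex G₁) (G₂ : Graph) (v : Vertex G₂) where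

  StarVertex : Set
  StarVertex = (G₁ ∖ᵛ u) ⊎ (G₂ ∖ᵛ v)

  StarEdge : Set
  StarEdge = (G₁ ∖ᵉ u) ⊎ (G₂ ∖ᵉ v) ⊎ Fin 3

  starEnds : OrderedStar G₁ u → OrderedStar G₂ v → StarEdge → StarVertex × StarVertex
  starEnds s t (inj₁ e)        = map inj₁ inj₁ (deleteEnds G₁ u e)
  starEnds s t (inj₂ (inj₁ e)) = map inj₂ inj₂ (deleteEnds G₂ v e)
  starEnds s t (inj₂ (inj₂ i)) =
    inj₁ (OrderedStar.neighbour s i) , inj₂ (OrderedStar.neighbour t i)

record Isomorphism {V E V′ E′ : Set}
                   (f : E → V × V) (g : E′ → V′ × V′) : Set where
  field
    vertex : V ↔ V′
    edge   : E ↔ E′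
    ends-≈ : ∀ e → g (Inverse.to edge e)
                 ≈ map (Inverse.to vertex) (Inverse.to vertex) (f e)

-- "G is a graph G₁(u) * G₂(v)", for some orderings at u and v.  As G is a Graph,
-- it is in particular connected.

record IsStarProduct (G₁ : Graph) (u : Vertex G₁)
                     (G₂ : Graph) (v : Vertex G₂) (G : Graph) : Set where
  field
    starAt₁ : OrderedStar G₁ u
    starAt₂ : OrderedStar G₂ v
    iso     : Isomorphism (starEnds G₁ u G₂ v starAt₁ starAt₂) (ends G)

{-# OPTIONS --safe #-}
module Submission where

-- (i) Contracting one side of the 3-edge-cut X of G = G₁(u) * G₂(v) turns regular
-- spanning subgraphs of G into subgraphs of G₁ that are regular away from u.  Cubic
-- graphs have even order, so by the handshake lemma a perfect matching meets X in 1
-- or 3 edges, and a Hamiltonian cycle containing it in exactly 2, whence 1 for the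
-- matching.  Given a perfect matching M₁ of G₁ containing uuᵢ, some perfect matching
-- of G contains uᵢvᵢ; gluing its restriction to G₂ with M₁ gives a perfect matching
-- of G, and contracting a Hamiltonian cycle through it yields one through M₁.
--
-- (ii) K₄ * K₄ is the triangular prism, whose three rungs form a perfect matching
-- that is the whole of X.

open import Defs
open import Data.Bool using (Bool; true; false; if_then_else_)
open import Data.Fin using (Fin; zero; suc; _≟_; punchIn; _↑ˡ_)
open import Data.Fin.Patterns using (0F; 1F; 2F; 3F; 4F; 5F; 6F; 7F; 8F)
open import Data.Fin.Properties using (all?; +↔⊎; ↑ˡ-injective; punchInᵢ≢i; suc-injective; 0≢1+n)
open import Data.Fin.Subset using (Subset; inside; outside; _∈_; _⊆_; _∩_; _─_; _-_; ∣_∣; ⊤; Nonempty)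
open import Data.Fin.Subset.Properties using (_∈?_; _⊆?_; anySubset?; ⊆⊤; ∈⊤; ⊆-antisym; drop-∷-⊆;
  p⊆q⇒∣p∣≤∣q∣; x∈p∩q⁻; x∈p∩q⁺; x∈p∧x∉q⇒x∈p─q; x∈p∧x≢y⇒x∈p-y; x∈p⇒∣p-x∣<∣p∣)
open import Data.Nat using (ℕ; zero; suc; _+_; _*_; _∸_; _≤_; _<_; z≤n; s≤s; _%_; nonZero)
import Data.Nat as ℕ
open import Data.Nat.DivMod using ([m+kn]%n≡m%n)
open import Data.Nat.Properties using (≤-antisym; ≤-trans; ≤-pred; ≤-reflexive; n≮0; +-assoc; +-comm; +-suc;
  +-identityʳ; +-cancelʳ-≡; *-zeroʳ; m+n∸n≡m; +-0-commutativeMonoid)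
open import Data.Nat.Tactic.RingSolver using (solve-∀)
open import Data.Product using (_×_; _,_; Σ-syntax; ∃-syntax; proj₁; proj₂; map)
open import Data.Sum using (_⊎_; inj₁; inj₂; [_,_]′)
import Data.Sum as Sum
open import Data.Sum.Algebra using (⊎-comm)
open import Data.Sum.Function.Propositional using (_⊎-↔_)
open import Data.Vec using ([]; _∷_; tabulate; lookup; here; there)
open import Data.Vec.Functional using (replicate)
open import Data.Vec.Properties using (lookup∘tabulate; tabulate∘lookup; tabulate-cong; []=⇒lookup; lookup⇒[]=)
open import Function using (_∘_; _↔_; Inverse; mk↔ₛ′; const; id)
open import Function.Definitions using (Injective)
open import Function.Properties.Inverse using (↔-trans; ↔-sym; ↔-refl)
open import Relation.Binary.Construct.Closure.ReflexiveTransitive using (Star; ε; _◅_; _◅◅_; kleisliStar; reverse)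
import Relation.Binary.Construct.Closure.ReflexiveTransitive as Star
open import Relation.Binary.PropositionalEquality using (_≡_; _≢_; refl; sym; trans; cong; cong₂; subst; ≢-sym;
  module ≡-Reasoning)
open import Relation.Nullary using (¬_; Dec; yes; no; does; contradiction)
open import Relation.Nullary.Decidable using (dec-true; dec-false; from-yes; from-no; ¬?; _×-dec_)

open import Algebra.Properties.CommutativeMonoid.Sum +-0-commutativeMonoid
  using (sum; sum-remove; ∑-distrib-+; sum-cong-≗; sum-replicate-zero)

private variable
  m n k l : ℕ

-- Cardinalities of finite subsets.

∈-tabulate⁺ : ∀ {P : Fin n → Set} (P? : ∀ i → Dec (P i)) {i} → P i → i ∈ tabulate (does ∘ P?)
∈-tabulate⁺ P? {i} Pi = lookup⇒[]= i _ (trans (lookup∘tabulate _ i) (dec-true (P? i) Pi))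

∈-tabulate⁻ : ∀ {P : Fin n → Set} (P? : ∀ i → Dec (P i)) {i} → i ∈ tabulate (does ∘ P?) → P i
∈-tabulate⁻ P? {i} i∈ with P? i | trans (sym (lookup∘tabulate (does ∘ P?) i)) ([]=⇒lookup i∈)
... | yes Pi | _ = Pi
... | no  _  | ()

-- Induction on `p`: the partner of the first element is deleted from `q`, and uniqueness keeps the
-- partners of all later elements. A relation serves instead of a function, so that the graph of a
-- map and its converse can both be used without building an inverse.
∣p∣≤∣q∣-by : (R : Fin m → Fin n → Set) {p : Subset m} {q : Subset n} →
            (∀ {i} → i ∈ p → ∃[ j ] (j ∈ q × R i j)) →
            (∀ {i i′ j} → R i j → R i′ j → i ≡ i′) → ∣ p ∣ ≤ ∣ q ∣
∣p∣≤∣q∣-by R {[]} total unique = z≤n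
∣p∣≤∣q∣-by R {outside ∷ p} total unique =
  ∣p∣≤∣q∣-by (R ∘ suc) (total ∘ there) (λ r r′ → suc-injective (unique r r′))
∣p∣≤∣q∣-by R {inside ∷ p} {q} total unique =
  let j , j∈q , r = total here
      total′ : ∀ {i} → i ∈ p → ∃[ j′ ] (j′ ∈ q - j × R (suc i) j′)
      total′ i∈p = let j′ , j′∈q , r′ = total (there i∈p) in
        j′ , x∈p∧x≢y⇒x∈p-y j′∈q (λ j′≡j → 0≢1+n (unique r (subst (R _) j′≡j r′))) , r′
  in ≤-trans (s≤s (∣p∣≤∣q∣-by (R ∘ suc) total′ (λ r r′ → suc-injective (unique r r′))))
             (x∈p⇒∣p-x∣<∣p∣ j∈q)

∣p∣≡∣q∣-by : (φ : Fin m → Fin n) {p : Subset m} {q : Subset n} → Injective _≡_ _≡_ φ →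
            (∀ {i} → i ∈ p → φ i ∈ q) →
            (∀ {j} → j ∈ q → ∃[ i ] (i ∈ p × φ i ≡ j)) → ∣ p ∣ ≡ ∣ q ∣
∣p∣≡∣q∣-by φ φ-injective into onto = ≤-antisym
  (∣p∣≤∣q∣-by (λ i j → φ i ≡ j) (λ i∈p → φ _ , into i∈p , refl) (λ { refl eq → φ-injective (sym eq) }))
  (∣p∣≤∣q∣-by (λ j i → φ i ≡ j) onto (λ { refl eq → eq }))

∣p∣≡1⇒unique : ∀ {p : Subset n} {i j} → ∣ p ∣ ≡ 1 → i ∈ p → j ∈ p → i ≡ j
∣p∣≡1⇒unique {p = p} {i} {j} ∣p∣≡1 i∈p j∈p with i ≟ j
... | yes i≡j = i≡j
... | no  i≢j = contradiction
  -- Deleting the distinct elements `i` and `j` lowers the cardinality at least twice, which is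
  -- impossible from 1.
  (≤-trans (s≤s (x∈p⇒∣p-x∣<∣p∣ (x∈p∧x≢y⇒x∈p-y j∈p (≢-sym i≢j)))) (x∈p⇒∣p-x∣<∣p∣ i∈p))
  (λ lt → n≮0 (≤-pred (subst (suc (suc ∣ p - i - j ∣) ≤_) ∣p∣≡1 lt)))

∣p∣>0⇒Nonempty : ∀ {p : Subset n} → 0 < ∣ p ∣ → Nonempty p
∣p∣>0⇒Nonempty {p = outside ∷ p} lt = let i , i∈p = ∣p∣>0⇒Nonempty lt in suc i , there i∈p
∣p∣>0⇒Nonempty {p = inside  ∷ p} lt = zero , here

∣q─p∩r∣+∣p∩r∣≡∣q∩r∣ : ∀ {p q : Subset n} (r : Subset n) → p ⊆ q → ∣ (q ─ p) ∩ r ∣ + ∣ p ∩ r ∣ ≡ ∣ q ∩ r ∣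
∣q─p∩r∣+∣p∩r∣≡∣q∩r∣ {p = []} {[]} [] p⊆q = refl
∣q─p∩r∣+∣p∩r∣≡∣q∩r∣ {p = outside ∷ p} {outside ∷ q} (c ∷ r) p⊆q = ∣q─p∩r∣+∣p∩r∣≡∣q∩r∣ r (drop-∷-⊆ p⊆q)
∣q─p∩r∣+∣p∩r∣≡∣q∩r∣ {p = outside ∷ p} {inside  ∷ q} (outside ∷ r) p⊆q = ∣q─p∩r∣+∣p∩r∣≡∣q∩r∣ r (drop-∷-⊆ p⊆q)
∣q─p∩r∣+∣p∩r∣≡∣q∩r∣ {p = outside ∷ p} {inside  ∷ q} (inside ∷ r) p⊆q = cong suc (∣q─p∩r∣+∣p∩r∣≡∣q∩r∣ r (drop-∷-⊆ p⊆q))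
∣q─p∩r∣+∣p∩r∣≡∣q∩r∣ {p = inside  ∷ p} {q ∷ qs} (c ∷ r) p⊆q with p⊆q here
∣q─p∩r∣+∣p∩r∣≡∣q∩r∣ {p = inside  ∷ p} {inside ∷ q} (outside ∷ r) p⊆q | here = ∣q─p∩r∣+∣p∩r∣≡∣q∩r∣ r (drop-∷-⊆ p⊆q)
∣q─p∩r∣+∣p∩r∣≡∣q∩r∣ {p = inside  ∷ p} {inside ∷ q} (inside ∷ r) p⊆q | here =
  trans (+-suc _ _) (cong suc (∣q─p∩r∣+∣p∩r∣≡∣q∩r∣ r (drop-∷-⊆ p⊆q)))

-- The handshake lemma.

indicator : {A : Set} → Dec A → ℕ
indicator A? = if does A? then 1 else 0

-- The extra `k` on the left stands in for the exceptional position `i`; this keeps `n - 1` out of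
-- the formula.
sum-all-but-one : (f : Fin n → ℕ) (i : Fin n) → (∀ j → j ≢ i → f j ≡ k) → sum f + k ≡ f i + n * k
sum-all-but-one {suc n} {k} f i const = begin
  sum f + k                                ≡⟨ cong (_+ k) (sum-remove f) ⟩
  f i + sum (λ j → f (punchIn i j)) + k    ≡⟨ cong (λ s → f i + s + k) (sum-cong-≗ (λ j → const _ (punchInᵢ≢i i j))) ⟩
  f i + sum (replicate n k) + k            ≡⟨ cong (λ s → f i + s + k) (sum-const n) ⟩
  f i + n * k + k                          ≡⟨ +-assoc (f i) _ _ ⟩
  f i + (n * k + k)                        ≡⟨ cong (f i +_) (+-comm (n * k) k) ⟩
  f i + suc n * k                          ∎
  where
  open ≡-Reasoning
  sum-const : ∀ n → sum (replicate n k) ≡ n * k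
  sum-const zero    = refl
  sum-const (suc n) = cong (k +_) (sum-const n)

sum-indicator : (i : Fin n) → sum (λ x → indicator (x ≟ i)) ≡ 1
sum-indicator {n} i = begin
  sum (λ x → indicator (x ≟ i))      ≡⟨ +-identityʳ _ ⟨
  sum (λ x → indicator (x ≟ i)) + 0  ≡⟨ sum-all-but-one (λ x → indicator (x ≟ i)) i off-i ⟩
  indicator (i ≟ i) + n * 0          ≡⟨ cong₂ _+_ (cong (if_then 1 else 0) (dec-true (i ≟ i) refl)) (*-zeroʳ n) ⟩
  1                                  ∎
  where
  open ≡-Reasoning
  off-i : ∀ j → j ≢ i → indicator (j ≟ i) ≡ 0
  off-i j j≢i = cong (if_then 1 else 0) (dec-false (j ≟ i) j≢i)

-- Since the two ends differ, the incidence indicator is the sum of the indicators of the ends; for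
-- a loop the total would be 1.
sum-incident : (ends : Fin m → Fin n × Fin n) → ∀ e → proj₁ (ends e) ≢ proj₂ (ends e) →
               sum (λ x → indicator (incident? ends x e)) ≡ 2
sum-incident ends e a≢b = begin
  sum (λ x → indicator (incident? ends x e))                         ≡⟨ sum-cong-≗ split ⟩
  sum (λ x → indicator (x ≟ a) + indicator (x ≟ b))                  ≡⟨ ∑-distrib-+ (λ x → indicator (x ≟ a)) _ ⟩
  sum (λ x → indicator (x ≟ a)) + sum (λ x → indicator (x ≟ b))      ≡⟨ cong₂ _+_ (sum-indicator a) (sum-indicator b) ⟩
  2                                                                  ∎
  where
  open ≡-Reasoning
  a = proj₁ (ends e)
  b = proj₂ (ends e)
  split : ∀ x → indicator (incident? ends x e) ≡ indicator (x ≟ a) + indicator (x ≟ b)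
  split x with x ≟ a | x ≟ b
  ... | yes x≡a | yes x≡b = contradiction (trans (sym x≡a) x≡b) a≢b
  ... | yes _   | no  _   = refl
  ... | no  _   | yes _   = refl
  ... | no  _   | no  _   = refl

-- Edges are peeled off one at a time while the vertex set stays fixed; each edge of `S` contributes
-- 2 by `sum-incident`.
handshake : (ends : Fin m → Fin n × Fin n) → (∀ e → proj₁ (ends e) ≢ proj₂ (ends e)) →
            ∀ S → sum (degreeIn ends S) ≡ ∣ S ∣ * 2
handshake {n = n} ends loopless [] = sum-replicate-zero n
handshake ends loopless (outside ∷ S) = handshake (ends ∘ suc) (loopless ∘ suc) S
handshake ends loopless (inside ∷ S) = begin
  sum (degreeIn ends (inside ∷ S))
    ≡⟨ sum-cong-≗ split ⟩
  sum (λ x → indicator (incident? ends x zero) + degreeIn (ends ∘ suc) S x)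
    ≡⟨ ∑-distrib-+ (λ x → indicator (incident? ends x zero)) _ ⟩
  sum (λ x → indicator (incident? ends x zero)) + sum (degreeIn (ends ∘ suc) S)
    ≡⟨ cong₂ _+_ (sum-incident ends zero (loopless zero)) (handshake (ends ∘ suc) (loopless ∘ suc) S) ⟩
  2 + ∣ S ∣ * 2 ∎
  where
  open ≡-Reasoning
  split : ∀ x → degreeIn ends (inside ∷ S) x ≡ indicator (incident? ends x zero) + degreeIn (ends ∘ suc) S x
  split x with does (incident? ends x zero)
  ... | true  = refl
  ... | false = refl

-- Degrees in nested edge sets.

module _ (ends : Fin m → Fin n × Fin n) where

  degreeIn-mono : ∀ S T → S ⊆ T → ∀ x → degreeIn ends S x ≤ degreeIn ends T x
  degreeIn-mono S T S⊆T x = p⊆q⇒∣p∣≤∣q∣ λ e∈ →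
    let e∈S , e∈x = x∈p∩q⁻ S _ e∈ in x∈p∩q⁺ (S⊆T e∈S , e∈x)

  -- Degrees of `T ─ S` and `S` add up to those of `T`. For a matching inside a 2-factor, and for a
  -- 2-factor inside a cubic graph, `l ∸ k` computes to 1, so the difference is again a perfect
  -- matching.
  difference-regular : ∀ S T → RegularSpanning ends k S → RegularSpanning ends l T → S ⊆ T →
                       RegularSpanning ends (l ∸ k) (T ─ S)
  difference-regular {k} {l} S T S-reg T-reg S⊆T x = begin
    degreeIn ends (T ─ S) x          ≡⟨ m+n∸n≡m _ k ⟨
    degreeIn ends (T ─ S) x + k ∸ k  ≡⟨ cong (λ d → degreeIn ends (T ─ S) x + d ∸ k) (S-reg x) ⟨
    degreeIn ends (T ─ S) x + degreeIn ends S x ∸ k  ≡⟨ cong (_∸ k) (trans (∣q─p∩r∣+∣p∩r∣≡∣q∩r∣ (edgesAt ends x) S⊆T) (T-reg x)) ⟩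
    l ∸ k ∎
    where open ≡-Reasoning

-- Unordered pairs of ends.

≈-sym : {V : Set} {p q : V × V} → p ≈ q → q ≈ p
≈-sym (inj₁ refl) = inj₁ refl
≈-sym (inj₂ refl) = inj₂ refl

≈-trans : {V : Set} {p q r : V × V} → p ≈ q → q ≈ r → p ≈ r
≈-trans (inj₁ refl) q≈r = q≈r
≈-trans (inj₂ refl) (inj₁ refl) = inj₂ refl
≈-trans (inj₂ refl) (inj₂ refl) = inj₁ refl

≈-map : {V W : Set} (h : V → W) {p q : V × V} → p ≈ q → map h h p ≈ map h h q
≈-map h (inj₁ refl) = inj₁ refl
≈-map h (inj₂ refl) = inj₂ refl

-- `Incident ends x e` unfolds to `EndOf x (ends e)`; with the pair as an argument, incidence can be
-- carried along `≈` and `map`.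
EndOf : {V : Set} → V → V × V → Set
EndOf x p = x ≡ proj₁ p ⊎ x ≡ proj₂ p

EndOf-≈ : {V : Set} {x : V} {p q : V × V} → p ≈ q → EndOf x p → EndOf x q
EndOf-≈ (inj₁ refl) end        = end
EndOf-≈ (inj₂ refl) (inj₁ end) = inj₂ end
EndOf-≈ (inj₂ refl) (inj₂ end) = inj₁ end

EndOf-map : {V W : Set} (h : V → W) {x : V} {p : V × V} → EndOf x p → EndOf (h x) (map h h p)
EndOf-map h (inj₁ refl) = inj₁ refl
EndOf-map h (inj₂ refl) = inj₂ refl

-- Parity of the degree at an exceptional vertex.

module _ (G : Graph) (cubic : Cubic G) (S : Subset (size G)) (u : Vertex G)
         (regular : ∀ x → x ≢ u → degreeIn (ends G) S x ≡ k) where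

  -- With `d` the degree at `u` and `o` the order, handshake for `S` gives `h`, and handshake for
  -- all edges gives `h⊤`, which makes `o` even. Adding `k` times the latter to the former yields an
  -- equation in which everything but `d` and `k` is visibly even, with no subtraction.
  degreeIn-parity : degreeIn (ends G) S u % 2 ≡ k % 2
  degreeIn-parity = begin
    d % 2                          ≡⟨ [m+kn]%n≡m%n d (s * k) 2 ⟨
    (d + s * k * 2) % 2            ≡⟨ cong (_% 2) eq ⟩
    (k + (∣ S ∣ + o * k) * 2) % 2  ≡⟨ [m+kn]%n≡m%n k (∣ S ∣ + o * k) 2 ⟩
    k % 2                          ∎
    where
    open ≡-Reasoning
    d = degreeIn (ends G) S u
    o = order G
    s = ∣ ⊤ {size G} ∣
    h : ∣ S ∣ * 2 + k ≡ d + o * k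
    h = trans (cong (_+ k) (sym (handshake (ends G) (Graph.loopless G) S)))
              (sum-all-but-one (degreeIn (ends G) S) u regular)
    h⊤ : s * 2 ≡ o * 3
    h⊤ = +-cancelʳ-≡ 3 _ _ (begin
      s * 2 + 3 ≡⟨ cong (_+ 3) (handshake (ends G) (Graph.loopless G) ⊤) ⟨
      sum (degreeIn (ends G) ⊤) + 3 ≡⟨ sum-all-but-one _ u (λ x _ → cubic x) ⟩
      degreeIn (ends G) ⊤ u + o * 3 ≡⟨ cong (_+ o * 3) (cubic u) ⟩
      3 + o * 3 ≡⟨ +-comm 3 _ ⟩
      o * 3 + 3 ∎)
    shuffle : ∀ s d k → d + s * k * 2 ≡ d + s * 2 * k
    shuffle = solve-∀
    shuffle′ : ∀ d o k → d + o * 3 * k ≡ d + o * k + o * k * 2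
    shuffle′ = solve-∀
    shuffle″ : ∀ c k o → c * 2 + k + o * k * 2 ≡ k + (c + o * k) * 2
    shuffle″ = solve-∀
    eq : d + s * k * 2 ≡ k + (∣ S ∣ + o * k) * 2
    eq = begin
      d + s * k * 2              ≡⟨ shuffle s d k ⟩
      d + s * 2 * k              ≡⟨ cong (λ t → d + t * k) h⊤ ⟩
      d + o * 3 * k              ≡⟨ shuffle′ d o k ⟩
      d + o * k + o * k * 2      ≡⟨ cong (_+ o * k * 2) h ⟨
      ∣ S ∣ * 2 + k + o * k * 2  ≡⟨ shuffle″ ∣ S ∣ k o ⟩
      k + (∣ S ∣ + o * k) * 2    ∎

-- An odd `a` is at least 1, so the even `b` lies between 1 and 3 and equals 2; this rules out
-- `a = 3`. Here `a` and `b` will count the cut edges in a matching and in a 2-factor containing it.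
odd≤even≤3 : ∀ {a b} → a ≤ b → b ≤ 3 → a % 2 ≡ 1 → b % 2 ≡ 0 → a ≡ 1 × b ≡ 2
odd≤even≤3 {1} {2} _ _ _ _ = refl , refl
odd≤even≤3 {0} _ _ () _
odd≤even≤3 {2} _ _ () _
odd≤even≤3 {1} {1} _ _ _ ()
odd≤even≤3 {1} {3} _ _ _ ()
odd≤even≤3 {_} {suc (suc (suc (suc _)))} _ (s≤s (s≤s (s≤s ()))) _ _
odd≤even≤3 {suc (suc (suc _))} {3} _ _ _ ()
odd≤even≤3 {suc (suc (suc _))} {2} (s≤s (s≤s ())) _ _ _

-- Contractions and the edge sets they induce.

-- K arises from G by identifying a set of vertices to u and dropping the edges
-- that become loops.
record Contraction (G K : Graph) (u : Vertex K) : Set where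
  field
    collapse            : Vertex G → Vertex K
    lift                : Edge K → Edge G
    lift-injective      : Injective _≡_ _≡_ lift
    lift-ends           : ∀ e → ends K e ≈ map collapse collapse (ends G (lift e))
    lifted-or-loop      : ∀ f → (∃[ e ] lift e ≡ f) ⊎ map collapse collapse (ends G f) ≡ (u , u)
    collapse-injective  : ∀ {y z} → collapse y ≢ u → collapse y ≡ collapse z → y ≡ z
    collapse-surjective : ∀ x → ∃[ y ] collapse y ≡ x

  restrict : Subset (size G) → Subset (size K)
  restrict S = tabulate (lookup S ∘ lift)

  restrict⁺ : ∀ {S e} → lift e ∈ S → e ∈ restrict S
  restrict⁺ {e = e} e∈ = lookup⇒[]= e _ (trans (lookup∘tabulate _ e) ([]=⇒lookup e∈))

  restrict⁻ : ∀ {S e} → e ∈ restrict S → lift e ∈ S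
  restrict⁻ {S} {e} e∈ = lookup⇒[]= _ S (trans (sym (lookup∘tabulate _ e)) ([]=⇒lookup e∈))

  restrict-mono : ∀ {S T} → S ⊆ T → restrict S ⊆ restrict T
  restrict-mono S⊆T = restrict⁺ ∘ S⊆T ∘ restrict⁻

  restrict-⊤ : restrict ⊤ ≡ ⊤
  restrict-⊤ = ⊆-antisym ⊆⊤ (λ _ → restrict⁺ ∈⊤)

  -- Away from the fibre over `u`, `lift` is a bijection between the edges at `collapse y` and those
  -- at `y`: an edge at `y` cannot become a loop at `u`, and `collapse` is injective there.
  restrict-degree : ∀ S y → collapse y ≢ u →
                    degreeIn (ends G) S y ≡ degreeIn (ends K) (restrict S) (collapse y)
  restrict-degree S y y≢u = sym (∣p∣≡∣q∣-by lift lift-injective into onto)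
    where
    EndOf-reflect : ∀ p → EndOf (collapse y) (map collapse collapse p) → EndOf y p
    EndOf-reflect p = Sum.map (collapse-injective y≢u) (collapse-injective y≢u)

    into : ∀ {e} → e ∈ restrict S ∩ edgesAt (ends K) (collapse y) → lift e ∈ S ∩ edgesAt (ends G) y
    into {e} e∈ = let e∈S , e∈y = x∈p∩q⁻ (restrict S) _ e∈ in
      x∈p∩q⁺ (restrict⁻ e∈S , ∈-tabulate⁺ (incident? (ends G) y)
        (EndOf-reflect _ (EndOf-≈ (lift-ends e) (∈-tabulate⁻ (incident? (ends K) (collapse y)) e∈y))))

    onto : ∀ {f} → f ∈ S ∩ edgesAt (ends G) y →
           ∃[ e ] (e ∈ restrict S ∩ edgesAt (ends K) (collapse y) × lift e ≡ f)
    onto {f} f∈ with x∈p∩q⁻ S _ f∈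
    ... | f∈S , f∈y with EndOf-map collapse (∈-tabulate⁻ (incident? (ends G) y) f∈y) | lifted-or-loop f
    ... | end | inj₁ (e , refl) = e , x∈p∩q⁺ (restrict⁺ f∈S ,
      ∈-tabulate⁺ (incident? (ends K) (collapse y)) (EndOf-≈ (≈-sym (lift-ends e)) end)) , refl
    ... | end | inj₂ loop with subst (EndOf (collapse y)) loop end
    ...   | inj₁ y≡u = contradiction y≡u y≢u
    ...   | inj₂ y≡u = contradiction y≡u y≢u

  restrict-regular : ∀ S → RegularSpanning (ends G) k S →
                     ∀ x → x ≢ u → degreeIn (ends K) (restrict S) x ≡ k
  restrict-regular S regular x x≢u with collapse-surjective x
  ... | y , refl = trans (sym (restrict-degree S y x≢u)) (regular y)

  -- A path in `G` is mapped edge by edge; an edge that becomes a loop contributes the empty path.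
  restrict-connected : ∀ {S} → ConnectedSpanning (ends G) S → ConnectedSpanning (ends K) (restrict S)
  restrict-connected {S} conn x x′ with collapse-surjective x | collapse-surjective x′
  ... | y , refl | y′ , refl = kleisliStar collapse step (conn y y′)
    where
    step : ∀ {a b} → ∃[ f ] (f ∈ S × Joins (ends G) f a b) →
           Star (λ a b → ∃[ e ] (e ∈ restrict S × Joins (ends K) e a b)) (collapse a) (collapse b)
    step (f , f∈S , joins) with ≈-map collapse joins | lifted-or-loop f
    ... | joins′ | inj₁ (e , refl) = (e , restrict⁺ f∈S , ≈-trans (lift-ends e) joins′) ◅ ε
    ... | joins′ | inj₂ loop = stationary (subst (_≈ _) loop joins′)
      where
      stationary : ∀ {R : Vertex K → Vertex K → Set} {x x′} → (u , u) ≈ (x , x′) → Star R x x′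
      stationary (inj₁ refl) = ε
      stationary (inj₂ refl) = ε

  -- The edges of K at u form a 3-edge-cut of G.  By parity a perfect matching of
  -- G uses an odd number of them and a 2-regular subgraph an even number.
  restrict-matching-in-2-factor : Cubic K → ∀ M H →
    PerfectMatching G M → RegularSpanning (ends G) 2 H → M ⊆ H →
    PerfectMatching K (restrict M) × RegularSpanning (ends K) 2 (restrict H)
  restrict-matching-in-2-factor cubic M H M-reg H-reg M⊆H =
    regular (restrict M) (restrict-regular M M-reg) (proj₁ degrees) ,
    regular (restrict H) (restrict-regular H H-reg) (proj₂ degrees)
    where
    degrees : degreeIn (ends K) (restrict M) u ≡ 1 × degreeIn (ends K) (restrict H) u ≡ 2
    degrees = odd≤even≤3
      (degreeIn-mono (ends K) (restrict M) (restrict H) (restrict-mono M⊆H) u)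
      (subst (degreeIn (ends K) (restrict H) u ≤_) (cubic u) (degreeIn-mono (ends K) (restrict H) ⊤ ⊆⊤ u))
      (degreeIn-parity K cubic (restrict M) u (restrict-regular M M-reg))
      (degreeIn-parity K cubic (restrict H) u (restrict-regular H H-reg))

    regular : ∀ S → (∀ x → x ≢ u → degreeIn (ends K) S x ≡ k) → degreeIn (ends K) S u ≡ k →
              RegularSpanning (ends K) k S
    regular S off at x with x ≟ u
    ... | yes refl = at
    ... | no  x≢u  = off x x≢u

  -- Parity alone would allow three edges of `M` at `u`. The Hamiltonian cycle through `M` that PMH
  -- provides excludes this.
  restrict-matching : Cubic K → PMH G → ∀ M → PerfectMatching G M → PerfectMatching K (restrict M)
  restrict-matching cubic (_ , extend) M M-pm =
    let H , (H-reg , _) , M⊆H = extend M M-pm in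
    proj₁ (restrict-matching-in-2-factor cubic M H M-pm H-reg M⊆H)

-- The three edges at a vertex of degree 3.

module _ {K : Graph} {u : Vertex K} (s : OrderedStar K u) where
  open OrderedStar s

  edge-incident : ∀ i → Incident (ends K) u (edge i)
  edge-incident i = EndOf-≈ (≈-sym (joins i)) (inj₁ refl)

  split-edge : Edge K → (K ∖ᵉ u) ⊎ Fin 3
  split-edge e with incident? (ends K) u e
  ... | yes u∈e = inj₂ (proj₁ (complete e u∈e))
  ... | no  u∉e = inj₁ (e , u∉e)

  unsplit-edge : (K ∖ᵉ u) ⊎ Fin 3 → Edge K
  unsplit-edge = [ proj₁ , edge ]′

  unsplit∘split : ∀ e → unsplit-edge (split-edge e) ≡ e
  unsplit∘split e with incident? (ends K) u e
  ... | yes u∈e = sym (proj₂ (complete e u∈e))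
  ... | no  u∉e = refl

  split∘unsplit : ∀ p → split-edge (unsplit-edge p) ≡ p
  split∘unsplit (inj₁ (e , u∉e)) with incident? (ends K) u e
  ... | yes u∈e = contradiction u∈e u∉e
  -- The given and the decided proof of non-incidence agree definitionally, negations being
  -- irrelevant.
  ... | no  _   = refl
  split∘unsplit (inj₂ i) with incident? (ends K) u (edge i)
  ... | yes u∈e = cong inj₂ (distinct (sym (proj₂ (complete (edge i) u∈e))))
  ... | no  u∉e = contradiction (edge-incident i) u∉e

  matching-edge : ∀ M → PerfectMatching K M → ∃[ i ] edge i ∈ M
  matching-edge M pm =
    let e , e∈ = ∣p∣>0⇒Nonempty (≤-reflexive (sym (pm u)))
        e∈M , e∈u = x∈p∩q⁻ M _ e∈
        i , e≡ = complete e (∈-tabulate⁻ (incident? (ends K) u) e∈u)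
    in i , subst (_∈ M) e≡ e∈M

  -- The pattern of `M` on the star depends on `i` alone. Hence two matchings, one on each side of
  -- the cut, agree on all three edges as soon as they share one index, as gluing requires.
  matching-edges : ∀ M {i} → PerfectMatching K M → edge i ∈ M → ∀ j → lookup M (edge j) ≡ does (j ≟ i)
  matching-edges M {i} pm i∈M j with j ≟ i
  ... | yes refl = []=⇒lookup i∈M
  ... | no  j≢i with lookup M (edge j) in eq
  ...   | false = refl
  ...   | true  = contradiction (distinct (∣p∣≡1⇒unique (pm u) (at (lookup⇒[]= _ M eq)) (at i∈M))) j≢i
    where
    at : ∀ {j} → edge j ∈ M → edge j ∈ M ∩ edgesAt (ends K) u
    at {j} ∈M = x∈p∩q⁺ (∈M , ∈-tabulate⁺ (incident? (ends K) u) (edge-incident j))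

-- Star products and their contractions.

-- This allows every argument to be made for the left factor only. Cut edges keep their index but
-- have their ends reversed, which `≈` absorbs.
star-sym : ∀ {G₁ u G₂ v G} → IsStarProduct G₁ u G₂ v G → IsStarProduct G₂ v G₁ u G
star-sym {G₁} {u} {G₂} {v} {G} P = record
  { starAt₁ = starAt₂
  ; starAt₂ = starAt₁
  ; iso     = record
    { vertex = ↔-trans (⊎-comm _ _) vertex
    ; edge   = ↔-trans (mk↔ₛ′ exchange exchange exchange-involutive exchange-involutive) edge
    ; ends-≈ = ends-≈′
    }
  }
  where
  open IsStarProduct P
  open Isomorphism iso
  exchange : {A B C : Set} → A ⊎ B ⊎ C → B ⊎ A ⊎ C
  exchange (inj₁ a)        = inj₂ (inj₁ a)
  exchange (inj₂ (inj₁ b)) = inj₁ b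
  exchange (inj₂ (inj₂ c)) = inj₂ (inj₂ c)
  exchange-involutive : {A B C : Set} (x : A ⊎ B ⊎ C) → exchange (exchange x) ≡ x
  exchange-involutive (inj₁ a)        = refl
  exchange-involutive (inj₂ (inj₁ b)) = refl
  exchange-involutive (inj₂ (inj₂ c)) = refl
  toV = Inverse.to vertex ∘ Sum.swap
  ends-≈′ : ∀ e → ends G (Inverse.to edge (exchange e))
                ≈ map toV toV (starEnds G₂ v G₁ u starAt₂ starAt₁ e)
  ends-≈′ (inj₁ e)        = ends-≈ (inj₂ (inj₁ e))
  ends-≈′ (inj₂ (inj₁ e)) = ends-≈ (inj₁ e)
  ends-≈′ (inj₂ (inj₂ i)) = ≈-trans (ends-≈ (inj₂ (inj₂ i))) (inj₂ refl)

module _ {G₁ : Graph} {u : Vertex G₁} {G₂ : Graph} {v : Vertex G₂} {G : Graph}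
         (P : IsStarProduct G₁ u G₂ v G) where
  open IsStarProduct P
  open Isomorphism iso
  open OrderedStar using (joins; neighbour)

  private
    module V = Inverse vertex
    module E = Inverse edge

  embed : (G₁ ∖ᵉ u) ⊎ Fin 3 → StarEdge G₁ u G₂ v
  embed = [ inj₁ , inj₂ ∘ inj₂ ]′

  -- All of `G₂ - v` goes to `u`, so cut edges become the edges at `u` and the edges of `G₂ - v`
  -- become loops.
  project : StarVertex G₁ u G₂ v → Vertex G₁
  project = [ proj₁ , const u ]′

  projected-ends : ∀ f → map (project ∘ V.from) (project ∘ V.from) (ends G (E.to f))
                       ≈ map project project (starEnds G₁ u G₂ v starAt₁ starAt₂ f)
  projected-ends f = ≈-trans (≈-map (project ∘ V.from) (ends-≈ f))
    (inj₁ (cong₂ _,_ (cong project (V.strictlyInverseʳ _)) (cong project (V.strictlyInverseʳ _))))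

  contraction : Contraction G G₁ u
  contraction = record
    { collapse            = project ∘ V.from
    ; lift                = lift
    ; lift-injective      = lift-injective
    ; lift-ends           = λ e → ≈-trans (split-ends e) (≈-sym (projected-ends (embed (split-edge starAt₁ e))))
    ; lifted-or-loop      = λ f → subst LiftedOrLoop (E.strictlyInverseˡ f) (lifted-or-loop (E.from f))
    ; collapse-injective  = λ y≢u eq → trans (sym (V.strictlyInverseˡ _))
                              (trans (cong V.to (project-injective _ _ y≢u eq)) (V.strictlyInverseˡ _))
    ; collapse-surjective = collapse-surjective
    }
    where
    lift : Edge G₁ → Edge G
    lift = E.to ∘ embed ∘ split-edge starAt₁

    embed-injective : ∀ p q → embed p ≡ embed q → p ≡ q
    embed-injective (inj₁ _) (inj₁ _) refl = refl
    embed-injective (inj₂ _) (inj₂ _) refl = refl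

    lift-injective : Injective _≡_ _≡_ lift
    lift-injective {e} {e′} eq = begin
      e                                            ≡⟨ unsplit∘split starAt₁ e ⟨
      unsplit-edge starAt₁ (split-edge starAt₁ e)   ≡⟨ cong (unsplit-edge starAt₁) (embed-injective (split-edge starAt₁ e) (split-edge starAt₁ e′) embedded) ⟩
      unsplit-edge starAt₁ (split-edge starAt₁ e′)  ≡⟨ unsplit∘split starAt₁ e′ ⟩
      e′                                           ∎
      where
      open ≡-Reasoning
      embedded : embed (split-edge starAt₁ e) ≡ embed (split-edge starAt₁ e′)
      embedded = trans (sym (E.strictlyInverseʳ _)) (trans (cong E.from eq) (E.strictlyInverseʳ _))

    unsplit-ends : ∀ p → ends G₁ (unsplit-edge starAt₁ p)
                       ≈ map project project (starEnds G₁ u G₂ v starAt₁ starAt₂ (embed p))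
    unsplit-ends (inj₁ e) = inj₁ refl
    unsplit-ends (inj₂ i) = ≈-trans (joins starAt₁ i) (inj₂ refl)

    split-ends : ∀ e → ends G₁ e ≈ map project project (starEnds G₁ u G₂ v starAt₁ starAt₂ (embed (split-edge starAt₁ e)))
    split-ends e = ≈-trans (inj₁ (cong (ends G₁) (sym (unsplit∘split starAt₁ e)))) (unsplit-ends (split-edge starAt₁ e))

    LiftedOrLoop : Edge G → Set
    LiftedOrLoop f = (∃[ e ] lift e ≡ f) ⊎ map (project ∘ V.from) (project ∘ V.from) (ends G f) ≡ (u , u)

    lifted-or-loop : ∀ f → LiftedOrLoop (E.to f)
    lifted-or-loop (inj₁ e)        = inj₁ (_ , cong (E.to ∘ embed) (split∘unsplit starAt₁ (inj₁ e)))
    lifted-or-loop (inj₂ (inj₂ i)) = inj₁ (_ , cong (E.to ∘ embed) (split∘unsplit starAt₁ (inj₂ i)))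
    -- The pair `(u , u)` is its own swap, so both cases of `≈` give the same equation.
    lifted-or-loop (inj₂ (inj₁ e)) = inj₂ ([ id , id ]′ (projected-ends (inj₂ (inj₁ e))))

    project-injective : ∀ a b → project a ≢ u → project a ≡ project b → a ≡ b
    project-injective (inj₂ _) _        a≢u _    = contradiction refl a≢u
    project-injective (inj₁ _) (inj₂ _) a≢u a≡u  = contradiction a≡u a≢u
    project-injective (inj₁ _) (inj₁ _) a≢u refl = refl

    collapse-surjective : ∀ x → ∃[ y ] project (V.from y) ≡ x
    collapse-surjective x with x ≟ u
    -- The fibre over `u` is inhabited by a neighbour of `v`.
    ... | yes refl = V.to (inj₂ (neighbour starAt₂ zero)) , cong project (V.strictlyInverseʳ _)
    ... | no  x≢u  = V.to (inj₁ (x , x≢u)) , cong project (V.strictlyInverseʳ _)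

  cut-edge : Fin 3 → Edge G
  cut-edge i = E.to (inj₂ (inj₂ i))

  lift-edge : ∀ i → Contraction.lift contraction (OrderedStar.edge starAt₁ i) ≡ cut-edge i
  lift-edge i = cong (E.to ∘ embed) (split∘unsplit starAt₁ (inj₂ i))

  -- The values of `g` on the edges of `G₂ - v` are left free because `lift` never reaches those
  -- edges.
  restrict-tabulate : ∀ (g : StarEdge G₁ u G₂ v → Bool) {S : Subset (size G₁)} →
    (∀ e → g (inj₁ e) ≡ lookup S (proj₁ e)) → (∀ i → g (inj₂ (inj₂ i)) ≡ lookup S (OrderedStar.edge starAt₁ i)) →
    Contraction.restrict contraction (tabulate (g ∘ E.from)) ≡ S
  restrict-tabulate g {S} inner cut = trans (tabulate-cong pointwise) (tabulate∘lookup S)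
    where
    open ≡-Reasoning
    agree : ∀ p → g (embed p) ≡ lookup S (unsplit-edge starAt₁ p)
    agree (inj₁ e) = inner e
    agree (inj₂ i) = cut i
    pointwise : ∀ e → lookup (tabulate (g ∘ E.from)) (E.to (embed (split-edge starAt₁ e))) ≡ lookup S e
    pointwise e = begin
      lookup (tabulate (g ∘ E.from)) (E.to (embed (split-edge starAt₁ e)))  ≡⟨ lookup∘tabulate (g ∘ E.from) _ ⟩
      g (E.from (E.to (embed (split-edge starAt₁ e))))                       ≡⟨ cong g (E.strictlyInverseʳ _) ⟩
      g (embed (split-edge starAt₁ e))                                       ≡⟨ agree (split-edge starAt₁ e) ⟩
      lookup S (unsplit-edge starAt₁ (split-edge starAt₁ e))                 ≡⟨ cong (lookup S) (unsplit∘split starAt₁ e) ⟩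
      lookup S e                                                             ∎

-- Gluing matchings along the cut.

module _ {G₁ : Graph} {u : Vertex G₁} {G₂ : Graph} {v : Vertex G₂} {G : Graph}
         (P : IsStarProduct G₁ u G₂ v G) where
  open IsStarProduct P
  open Isomorphism iso
  private
    module V = Inverse vertex
    module E = Inverse edge
    module C₁ = Contraction (contraction P)
    module C₂ = Contraction (contraction (star-sym P))
    module s = OrderedStar starAt₁
    module t = OrderedStar starAt₂

  -- Each vertex of the star product avoids the fibre over `u` or the fibre over `v`, so its degree
  -- can be read off in one of the two contractions.
  star-regular : ∀ S → RegularSpanning (ends G₁) k (C₁.restrict S) → RegularSpanning (ends G₂) k (C₂.restrict S) →
                 RegularSpanning (ends G) k S
  star-regular {k} S regular₁ regular₂ y = [ left , right ]′ (off-u-or-v (V.from y))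
    where
    off-u-or-v : ∀ a → project P a ≢ u ⊎ project (star-sym P) (Sum.swap a) ≢ v
    off-u-or-v (inj₁ (_ , x≢u)) = inj₁ x≢u
    off-u-or-v (inj₂ (_ , x≢v)) = inj₂ x≢v

    left : C₁.collapse y ≢ u → degreeIn (ends G) S y ≡ k
    left y≢u = trans (C₁.restrict-degree S y y≢u) (regular₁ (C₁.collapse y))

    right : C₂.collapse y ≢ v → degreeIn (ends G) S y ≡ k
    right y≢v = trans (C₂.restrict-degree S y y≢v) (regular₂ (C₂.collapse y))

  star-cubic : Cubic G₁ → Cubic G₂ → Cubic G
  star-cubic cubic₁ cubic₂ = star-regular ⊤ (subst (RegularSpanning (ends G₁) 3) (sym C₁.restrict-⊤) cubic₁)
                                            (subst (RegularSpanning (ends G₂) 3) (sym C₂.restrict-⊤) cubic₂)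

  -- Inner edges take their value from their own side and cut edges from `M₁`. By `agree` the result
  -- also restricts to `M₂`, and `star-regular` applies.
  glue : ∀ M₁ M₂ → PerfectMatching G₁ M₁ → PerfectMatching G₂ M₂ →
         (∀ i → lookup M₁ (s.edge i) ≡ lookup M₂ (t.edge i)) →
         ∃[ M ] (PerfectMatching G M × C₁.restrict M ≡ M₁)
  glue M₁ M₂ pm₁ pm₂ agree = M , M-pm , restrict₁
    where
    g : StarEdge G₁ u G₂ v → Bool
    g (inj₁ e)        = lookup M₁ (proj₁ e)
    g (inj₂ (inj₁ e)) = lookup M₂ (proj₁ e)
    g (inj₂ (inj₂ i)) = lookup M₁ (s.edge i)

    M = tabulate (g ∘ E.from)

    restrict₁ : C₁.restrict M ≡ M₁
    restrict₁ = restrict-tabulate P g (λ _ → refl) (λ _ → refl)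

    restrict₂ : C₂.restrict M ≡ M₂
    restrict₂ = trans (cong C₂.restrict (tabulate-cong g-exchange))
                      (restrict-tabulate (star-sym P) g′ (λ _ → refl) (λ i → agree i))
      where
      -- `g` with the first two summands exchanged, to match the edge bijection of `star-sym P`.
      g′ : StarEdge G₂ v G₁ u → Bool
      g′ (inj₁ e)        = g (inj₂ (inj₁ e))
      g′ (inj₂ (inj₁ e)) = g (inj₁ e)
      g′ (inj₂ (inj₂ i)) = g (inj₂ (inj₂ i))
      g-exchange : ∀ f → g (E.from f) ≡ g′ (Inverse.from (Isomorphism.edge (IsStarProduct.iso (star-sym P))) f)
      g-exchange f with E.from f
      ... | inj₁ _        = refl
      ... | inj₂ (inj₁ _) = refl
      ... | inj₂ (inj₂ _) = refl

    M-pm : PerfectMatching G M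
    M-pm = star-regular M (subst (PerfectMatching G₁) (sym restrict₁) pm₁)
                          (subst (PerfectMatching G₂) (sym restrict₂) pm₂)

  -- A perfect matching M and a Hamiltonian cycle H containing it partition the
  -- edges of G into the perfect matchings M, H ─ M and ⊤ ─ H.
  matching-through : Cubic G → PMH G → ∀ f → ∃[ M ] (PerfectMatching G M × f ∈ M)
  matching-through cubic ((M , M-pm) , extend) f with extend M M-pm
  ... | H , (H-reg , _) , M⊆H with f ∈? M | f ∈? H
  ... | yes f∈M | _       = M , M-pm , f∈M
  ... | no  f∉M | yes f∈H = H ─ M , difference-regular (ends G) M H M-pm H-reg M⊆H , x∈p∧x∉q⇒x∈p─q f∈H f∉M
  ... | no  _   | no  f∉H = ⊤ ─ H , difference-regular (ends G) H ⊤ H-reg cubic ⊆⊤ , x∈p∧x∉q⇒x∈p─q ∈⊤ f∉H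

  module _ (cubic₁ : Cubic G₁) (cubic₂ : Cubic G₂) (pmh : PMH G) where

    -- `N` supplies the `G₂` side: its contraction is a perfect matching through the `i`-th edge at
    -- `v`, so by `matching-edges` it agrees with `M₁` on the cut.
    glue-through : ∀ M₁ N i → PerfectMatching G₁ M₁ → PerfectMatching G N → s.edge i ∈ M₁ → cut-edge P i ∈ N →
                   ∃[ M ] (PerfectMatching G M × C₁.restrict M ≡ M₁)
    glue-through M₁ N i pm₁ N-pm i∈M₁ i∈N = glue M₁ (C₂.restrict N) pm₁ pm₂ λ j →
      trans (matching-edges starAt₁ M₁ pm₁ i∈M₁ j) (sym (matching-edges starAt₂ (C₂.restrict N) pm₂ i∈M₂ j))
      where
      pm₂ : PerfectMatching G₂ (C₂.restrict N)
      pm₂ = C₂.restrict-matching cubic₂ pmh N N-pm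

      i∈M₂ : t.edge i ∈ C₂.restrict N
      i∈M₂ = C₂.restrict⁺ {N} {t.edge i} (subst (_∈ N) (sym (lift-edge (star-sym P) i)) i∈N)

    PMH-left : PMH G₁
    PMH-left = (C₁.restrict M₀ , C₁.restrict-matching cubic₁ pmh M₀ M₀-pm) , extend₁
      where
      M₀ : Subset (size G)
      M₀ = proj₁ (proj₁ pmh)

      M₀-pm : PerfectMatching G M₀
      M₀-pm = proj₂ (proj₁ pmh)

      restrict-cycle : ∀ M → PerfectMatching G M → ∃[ H₁ ] (HamiltonianCycle G₁ H₁ × C₁.restrict M ⊆ H₁)
      restrict-cycle M M-pm =
        let H , (H-reg , H-conn) , M⊆H = proj₂ pmh M M-pm in
        C₁.restrict H ,
        (proj₂ (C₁.restrict-matching-in-2-factor cubic₁ M H M-pm H-reg M⊆H) , C₁.restrict-connected {H} H-conn) ,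
        C₁.restrict-mono {M} {H} M⊆H

      extend₁ : ∀ M₁ → PerfectMatching G₁ M₁ → ∃[ H₁ ] (HamiltonianCycle G₁ H₁ × M₁ ⊆ H₁)
      extend₁ M₁ pm₁ =
        let i , i∈M₁       = matching-edge starAt₁ M₁ pm₁
            -- `N` uses the right cut edge but may differ from `M₁` on the left side; `M` repairs
            -- this.
            N , N-pm , i∈N = matching-through (star-cubic cubic₁ cubic₂) pmh (cut-edge P i)
            M , M-pm , M↦M₁ = glue-through M₁ N i pm₁ N-pm i∈M₁ i∈N
        in subst (λ M₁ → ∃[ H₁ ] (HamiltonianCycle G₁ H₁ × M₁ ⊆ H₁)) M↦M₁ (restrict-cycle M M-pm)

-- The counterexample: `K₄` and the triangular prism.

module _ (ends : Fin m → Fin n × Fin n) where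

  Adjacent : Subset m → Fin n → Fin n → Set
  Adjacent S a b = ∃[ e ] (e ∈ S × Joins ends e a b)

  connected-via : ∀ {S} r → (∀ x → Star (Adjacent S) x r) → ConnectedSpanning ends S
  connected-via r path x y =
    path x ◅◅ reverse (λ { (e , e∈S , joins) → e , e∈S , ≈-trans joins (inj₂ refl) }) (path y)

  connected-mono : ∀ {S T} → S ⊆ T → ConnectedSpanning ends S → ConnectedSpanning ends T
  connected-mono S⊆T conn x y = Star.map (λ { (e , e∈S , joins) → e , S⊆T e∈S , joins }) (conn x y)

  regular? : ∀ k S → Dec (RegularSpanning ends k S)
  regular? k S = all? (λ x → degreeIn ends S x ℕ.≟ k)

K₄-ends : Fin 6 → Fin 4 × Fin 4
K₄-ends = lookup ((0F , 1F) ∷ (0F , 2F) ∷ (0F , 3F) ∷ (1F , 2F) ∷ (1F , 3F) ∷ (2F , 3F) ∷ [])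

-- The 4-cycles 0-1-3-2 and 0-1-2-3. Each is the union of the matching {01, 23} with one of the
-- other two perfect matchings of `K₄`, so together they cover all three.
H₁ H₂ : Subset 6
H₁ = inside ∷ inside ∷ outside ∷ outside ∷ inside ∷ inside ∷ []
H₂ = inside ∷ outside ∷ inside ∷ inside ∷ outside ∷ inside ∷ []

H₁-connected : ConnectedSpanning K₄-ends H₁
H₁-connected = connected-via K₄-ends 0F path
  where
  path : ∀ x → Star (Adjacent K₄-ends H₁) x 0F
  path 0F = ε
  path 1F = (0F , from-yes (0F ∈? H₁) , inj₂ refl) ◅ ε
  path 2F = (1F , from-yes (1F ∈? H₁) , inj₂ refl) ◅ ε
  path 3F = (4F , from-yes (4F ∈? H₁) , inj₂ refl) ◅ path 1F

H₂-connected : ConnectedSpanning K₄-ends H₂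
H₂-connected = connected-via K₄-ends 0F path
  where
  path : ∀ x → Star (Adjacent K₄-ends H₂) x 0F
  path 0F = ε
  path 1F = (0F , from-yes (0F ∈? H₂) , inj₂ refl) ◅ ε
  path 2F = (3F , from-yes (3F ∈? H₂) , inj₂ refl) ◅ path 1F
  path 3F = (2F , from-yes (2F ∈? H₂) , inj₂ refl) ◅ ε

K₄ : Graph
K₄ = record
  { order     = 4
  ; size      = 6
  ; nonEmpty  = nonZero
  ; ends      = K₄-ends
  ; loopless  = from-yes (all? λ e → ¬? (proj₁ (K₄-ends e) ≟ proj₂ (K₄-ends e)))
  ; connected = connected-mono K₄-ends ⊆⊤ H₁-connected
  }

K₄-cubic : Cubic K₄
K₄-cubic = from-yes (regular? K₄-ends 3 ⊤)

K₄-PMH : PMH K₄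
K₄-PMH = (M , from-yes (regular? K₄-ends 1 M)) , extend
  where
  M : Subset 6
  M = inside ∷ outside ∷ outside ∷ outside ∷ outside ∷ inside ∷ []

  -- A negated existential, so that a search through all 64 edge sets settles it.
  covered : ¬ (∃[ M ] (PerfectMatching K₄ M × ¬ M ⊆ H₁ × ¬ M ⊆ H₂))
  covered = from-no (anySubset? λ M → regular? K₄-ends 1 M ×-dec ¬? (M ⊆? H₁) ×-dec ¬? (M ⊆? H₂))

  extend : ∀ M → PerfectMatching K₄ M → ∃[ H ] (HamiltonianCycle K₄ H × M ⊆ H)
  extend M pm with M ⊆? H₁ | M ⊆? H₂
  ... | yes M⊆H₁ | _        = H₁ , (from-yes (regular? K₄-ends 2 H₁) , H₁-connected) , M⊆H₁
  ... | no  _    | yes M⊆H₂ = H₂ , (from-yes (regular? K₄-ends 2 H₂) , H₂-connected) , M⊆H₂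
  ... | no  M⊈H₁ | no  M⊈H₂ = contradiction (M , pm , M⊈H₁ , M⊈H₂) covered

K₄-star : OrderedStar K₄ 0F
K₄-star = record
  -- `K₄-ends` lists the edges 01, 02, 03 first.
  { edge      = _↑ˡ 3
  ; neighbour = λ i → suc i , λ ()
  ; joins     = λ { 0F → inj₁ refl ; 1F → inj₁ refl ; 2F → inj₁ refl }
  ; distinct  = ↑ˡ-injective 3 _ _
  ; complete  = complete
  }
  where
  complete : ∀ e → Incident K₄-ends 0F e → ∃[ i ] e ≡ i ↑ˡ 3
  complete 0F _ = 0F , refl
  complete 1F _ = 1F , refl
  complete 2F _ = 2F , refl
  complete 3F (inj₁ ())
  complete 3F (inj₂ ())
  complete 4F (inj₁ ())
  complete 4F (inj₂ ())
  complete 5F (inj₁ ())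
  complete 5F (inj₂ ())

remaining-vertex : (K₄ ∖ᵛ 0F) ↔ Fin 3
remaining-vertex = mk↔ₛ′ to (λ i → suc i , λ ()) (λ _ → refl) from∘to
  where
  to : K₄ ∖ᵛ 0F → Fin 3
  to (zero  , 0≢0) = contradiction refl 0≢0
  to (suc i , _)   = i

  from∘to : ∀ x → (suc (to x) , λ ()) ≡ x
  from∘to (zero  , 0≢0) = contradiction refl 0≢0
  from∘to (suc i , _)   = refl

remaining-edge : (K₄ ∖ᵉ 0F) ↔ Fin 3
remaining-edge = mk↔ₛ′ to from (λ _ → refl) from∘to
  where
  to : K₄ ∖ᵉ 0F → Fin 3
  to (0F , ∉e) = contradiction (inj₁ refl) ∉e
  to (1F , ∉e) = contradiction (inj₁ refl) ∉e
  to (2F , ∉e) = contradiction (inj₁ refl) ∉e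
  to (suc (suc (suc i)) , _) = i

  from : Fin 3 → K₄ ∖ᵉ 0F
  from i = suc (suc (suc i)) , from-yes (all? λ i → ¬? (incident? K₄-ends 0F (suc (suc (suc i))))) i

  from∘to : ∀ e → from (to e) ≡ e
  from∘to (0F , ∉e) = contradiction (inj₁ refl) ∉e
  from∘to (1F , ∉e) = contradiction (inj₁ refl) ∉e
  from∘to (2F , ∉e) = contradiction (inj₁ refl) ∉e
  from∘to (suc (suc (suc i)) , _) = refl

prism-vertex : StarVertex K₄ 0F K₄ 0F ↔ Fin 6
prism-vertex = ↔-trans (remaining-vertex ⊎-↔ remaining-vertex) (↔-sym +↔⊎)

prism-edge : StarEdge K₄ 0F K₄ 0F ↔ Fin 9
prism-edge = ↔-trans (remaining-edge ⊎-↔ (↔-trans (remaining-edge ⊎-↔ ↔-refl) (↔-sym +↔⊎))) (↔-sym +↔⊎)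

-- Transported from `starEnds` instead of tabulated, so that the isomorphism reduces to an inverse
-- law of `prism-edge`. Edges 0 to 2 and 3 to 5 form the two triangles; 6 to 8 are the cut edges.
prism-ends : Fin 9 → Fin 6 × Fin 6
prism-ends f = map to to (starEnds K₄ 0F K₄ 0F K₄-star K₄-star (Inverse.from prism-edge f))
  where open Inverse prism-vertex using (to)

prism : Graph
prism = record
  { order     = 6
  ; size      = 9
  ; nonEmpty  = nonZero
  ; ends      = prism-ends
  ; loopless  = from-yes (all? λ e → ¬? (proj₁ (prism-ends e) ≟ proj₂ (prism-ends e)))
  ; connected = connected-via prism-ends 0F path
  }
  where
  path : ∀ x → Star (Adjacent prism-ends ⊤) x 0F
  path 0F = ε
  path 1F = (0F , from-yes (0F ∈? ⊤) , inj₂ refl) ◅ ε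
  path 2F = (1F , from-yes (1F ∈? ⊤) , inj₂ refl) ◅ ε
  path 3F = (6F , from-yes (6F ∈? ⊤) , inj₂ refl) ◅ ε
  path 4F = (7F , from-yes (7F ∈? ⊤) , inj₂ refl) ◅ path 1F
  path 5F = (8F , from-yes (8F ∈? ⊤) , inj₂ refl) ◅ path 2F

prism-isStarProduct : IsStarProduct K₄ 0F K₄ 0F prism
prism-isStarProduct = record
  { starAt₁ = K₄-star
  ; starAt₂ = K₄-star
  ; iso     = record
    { vertex = prism-vertex
    ; edge   = prism-edge
    ; ends-≈ = λ f → inj₁ (cong (map to to ∘ starEnds K₄ 0F K₄ 0F K₄-star K₄-star)
                                (Inverse.strictlyInverseʳ prism-edge f))
    }
  }
  where open Inverse prism-vertex using (to)

-- If the prism were PMH, the rungs would restrict to a perfect matching of `K₄`; but they restrict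
-- to all three edges at vertex 0, whose degree is then 3 and not 1.
prism-¬PMH : ¬ PMH prism
prism-¬PMH pmh = contradiction (restrict-matching K₄-cubic pmh rungs rungs-pm 0F) λ ()
  where
  open Contraction (contraction prism-isStarProduct)

  rungs : Subset 9
  rungs = outside ∷ outside ∷ outside ∷ outside ∷ outside ∷ outside ∷ inside ∷ inside ∷ inside ∷ []

  rungs-pm : PerfectMatching prism rungs
  rungs-pm = from-yes (regular? prism-ends 1 rungs)

proposition3p1 : ((G₁ G₂ : Graph) → Cubic G₁ → Cubic G₂ → order G₁ ≢ 2 → order G₂ ≢ 2 →
    (u : Vertex G₁) (v : Vertex G₂) (G : Graph) → IsStarProduct G₁ u G₂ v G →
    PMH G → PMH G₁ × PMH G₂)
    ×
    (Σ[ G₁ ∈ Graph ] Σ[ G₂ ∈ Graph ]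
    (Cubic G₁ × Cubic G₂ × order G₁ ≢ 2 × order G₂ ≢ 2 × PMH G₁ × PMH G₂ ×
    (Σ[ u ∈ Vertex G₁ ] Σ[ v ∈ Vertex G₂ ] Σ[ G ∈ Graph ]
    (IsStarProduct G₁ u G₂ v G × ¬ PMH G))))
proposition3p1 =
  (λ G₁ G₂ cubic₁ cubic₂ _ _ u v G P pmh →
    PMH-left P cubic₁ cubic₂ pmh , PMH-left (star-sym P) cubic₂ cubic₁ pmh) ,
  K₄ , K₄ , K₄-cubic , K₄-cubic , (λ ()) , (λ ()) , K₄-PMH , K₄-PMH ,
  0F , 0F , prism , prism-isStarProduct , prism-¬PMH
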